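{- For any graph $G$ with $n$ vertices, (i) $\gamma_{ir}(G) = n$ if and only if $G \simeq E_n$; (ii) $\gamma_{ir}(G) = n-1$ if and only if, for some integers $t \geq 0$ and $r \geq 1$, $G \simeq tK_1 \cup K_{1,r}$ or $G \simeq tK_1 \cup H$ for some $r$-regular graph $H$.
   Context: All graphs are finite, simple, undirected and have at least one vertex. $N(v)$ denotes the set of neighbours of a vertex $v$. A dominating set of $G$ is a set $D \subseteq V(G)$ such that every vertex in $V(G)\setminus D$ has a neighbour in $D$. An irregular dominating set of $G$ is a dominating set $D$ of $G$ such that $|N(u) \cap D| \neq |N(v) \cap D|$ for every two distinct vertices $u, v \in V(G) \setminus D$ (in particular, $V(G)$ is one). The irregular domination number $\gamma_{ir}(G)$ is the size of a smallest irregular dominating set of $G$. $\simeq$ denotes graph isomorphism, $E_n$ is the graph with $n$ vertices and no edges, $tK_1$ is the graph consisting of $t$ isolated vertices (no vertices if $t=0$), $K_{1,r}$ is the star with $r$ edges, and $\cup$ denotes vertex-disjoint union. -}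

module Defs where

open import Data.Empty using (⊥)
open import Data.Fin using (Fin; zero; suc; splitAt; _≟_)
open import Data.Fin.Properties using (all?; any?)
open import Data.Fin.Subset using (Subset; _∈_; _∉_; _∩_; ∣_∣) renaming (⊤ to full)
open import Data.Fin.Subset.Properties using (_∈?_; anySubset?; ∈⊤)
open import Data.Nat using (ℕ; suc; _+_; _≤_; _<_)
open import Data.Nat.Induction using (<-wellFounded)
open import Data.Nat.Properties using (_<?_; ≮⇒≥) renaming (_≟_ to _≟ℕ_)
open import Data.Product using (∃; Σ; _×_; _,_; proj₁)
open import Data.Sum using (inj₁; inj₂)
open import Data.Sum.Relation.Binary.Pointwise
  using (Pointwise; inj₁; inj₂; ⊎-symmetric; ⊎-decidable)
open import Data.Unit using (⊤; tt)
open import Data.Vec using (tabulate)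
open import Function.Bundles using (_↔_; _⇔_; Inverse)
open import Induction.WellFounded using (Acc; acc)
open import Relation.Binary.Core using (Rel)
open import Relation.Binary.Definitions using (Symmetric; Decidable)
open import Relation.Binary.PropositionalEquality using (_≡_; _≢_)
open import Relation.Nullary using (¬_; Dec; yes; no; does; contradiction)
open import Relation.Nullary.Decidable using (_×-dec_; _→-dec_; ¬?)
open import Level using (0ℓ)

-- A graph without vertices is allowed here, so that t K₁ makes sense for
-- t = 0; nonemptiness is a separate hypothesis where it is required.
record Graph (n : ℕ) : Set₁ where
  field
    Adj    : Rel (Fin n) 0ℓ
    adj?   : Decidable Adj
    sym    : Symmetric Adj
    irrefl : ∀ {v} → ¬ Adj v v

open Graph public using (Adj; adj?)

private
  variable
    m n : ℕ

N : (G : Graph n) → Fin n → Subset n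
N G v = tabulate λ u → does (adj? G v u)

record _≃_ (G : Graph m) (H : Graph n) : Set where
  field
    vertices : Fin m ↔ Fin n
    adjacent : ∀ u v →
      Adj G u v ⇔ Adj H (Inverse.to vertices u) (Inverse.to vertices v)

infix 4 _≃_

Regular : ℕ → Graph n → Set
Regular r G = ∀ v → ∣ N G v ∣ ≡ r

E : (n : ℕ) → Graph n
E n = record
  { Adj    = λ _ _ → ⊥
  ; adj?   = λ _ _ → no λ ()
  ; sym    = λ ()
  ; irrefl = λ ()
  }

_K₁ : (t : ℕ) → Graph t
t K₁ = E t

-- The centre of the star is the vertex zero.
StarAdj : ∀ {r} → Rel (Fin (suc r)) 0ℓ
StarAdj zero    zero    = ⊥
StarAdj zero    (suc _) = ⊤
StarAdj (suc _) zero    = ⊤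
StarAdj (suc _) (suc _) = ⊥

K₁,_ : (r : ℕ) → Graph (suc r)
K₁, r = record
  { Adj    = StarAdj
  ; adj?   = dec
  ; sym    = λ {u} {v} → symm u v
  ; irrefl = λ {v} → irr v
  }
  where
  dec : Decidable (StarAdj {r})
  dec zero    zero    = no λ ()
  dec zero    (suc _) = yes tt
  dec (suc _) zero    = yes tt
  dec (suc _) (suc _) = no λ ()

  symm : ∀ u v → StarAdj {r} u v → StarAdj {r} v u
  symm zero    (suc _) _ = tt
  symm (suc _) zero    _ = tt

  irr : ∀ v → ¬ StarAdj {r} v v
  irr zero    ()
  irr (suc _) ()

_∪_ : Graph m → Graph n → Graph (m + n)
_∪_ {m} G H = record
  { Adj    = λ u v → Pointwise (Adj G) (Adj H) (splitAt m u) (splitAt m v)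
  ; adj?   = λ u v → ⊎-decidable (adj? G) (adj? H) (splitAt m u) (splitAt m v)
  ; sym    = ⊎-symmetric (Graph.sym G) (Graph.sym H)
  ; irrefl = λ {v} → irr (splitAt m v)
  }
  where
  irr : ∀ x → ¬ Pointwise (Adj G) (Adj H) x x
  irr (inj₁ _) (inj₁ a) = Graph.irrefl G a
  irr (inj₂ _) (inj₂ a) = Graph.irrefl H a

infix  9 _K₁ K₁,_
infixr 6 _∪_

Dominating : Graph n → Subset n → Set
Dominating G D = ∀ v → v ∉ D → ∃ λ u → Adj G v u × u ∈ D

IrregularDominating : Graph n → Subset n → Set
IrregularDominating G D =
  Dominating G D ×
  (∀ u v → u ∉ D → v ∉ D → u ≢ v → ∣ N G u ∩ D ∣ ≢ ∣ N G v ∩ D ∣)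

SmallestIrregularDominating : Graph n → Subset n → Set
SmallestIrregularDominating G D =
  IrregularDominating G D × (∀ D′ → IrregularDominating G D′ → ∣ D ∣ ≤ ∣ D′ ∣)

irregularDominating? : (G : Graph n) (D : Subset n) → Dec (IrregularDominating G D)
irregularDominating? G D =
  (all? λ v → ¬? (v ∈? D) →-dec any? λ u → adj? G v u ×-dec u ∈? D)
  ×-dec
  (all? λ u → all? λ v → ¬? (u ∈? D) →-dec ¬? (v ∈? D) →-dec ¬? (u ≟ v) →-dec
    ¬? (∣ N G u ∩ D ∣ ≟ℕ ∣ N G v ∩ D ∣))

smallest : (G : Graph n) → ∃ (SmallestIrregularDominating G)
smallest {n} G = descend full full-irregular (<-wellFounded ∣ full {n} ∣)
  where
  full-irregular : IrregularDominating G full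
  full-irregular = (λ _ v∉ → contradiction ∈⊤ v∉) , λ _ _ u∉ → contradiction ∈⊤ u∉

  descend : ∀ D → IrregularDominating G D → Acc _<_ ∣ D ∣ →
            ∃ (SmallestIrregularDominating G)
  descend D irr (acc rec)
    with anySubset? (λ D′ → irregularDominating? G D′ ×-dec ∣ D′ ∣ <? ∣ D ∣)
  ... | yes (D′ , irr′ , D′<D) = descend D′ irr′ (rec D′<D)
  ... | no  none = D , irr , λ D′ irr′ → ≮⇒≥ λ D′<D → none (D′ , irr′ , D′<D)

γir : Graph n → ℕ
γir G = ∣ proj₁ (smallest G) ∣

{-# OPTIONS --safe #-}
-- If u and v are distinct non-isolated vertices, then V ∖ {u , v} fails to be an
-- irregular dominating set only if deg u = deg v, or u and v are adjacent and one
-- of them is a leaf.  So γir G = n - 1 forces either all non-isolated degrees to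
-- agree, or a leaf u attached to some c with deg c ≠ 1; comparing any further
-- non-isolated vertex with u and with c shows that it is a leaf attached to c.
-- Conversely, two vertices left out of D must be leaves in the star, with the
-- centre as only neighbour in D; in a regular graph, two vertices left out of D
-- have equal degrees in the subgraph induced by the complement of D, by pigeonhole,
-- hence as many neighbours in D.
module Submission where

open import Defs
open import Data.Bool using (true)
open import Data.Fin using (Fin; zero; suc; toℕ; fromℕ<; _≟_)
open import Data.Fin.Permutation using (transpose)
open import Data.Fin.Properties
  using (any?; all?; nonZeroIndex; toℕ-fromℕ<; +↔⊎; splitAt-join)
  renaming (suc-injective to Fin-suc-injective)
open import Data.Fin.Subset
  using (Subset; _∈_; _∉_; _⊆_; _∩_; _-_; ∁; ∣_∣; Nonempty; inside; outside)
  renaming (⊤ to full)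
open import Data.Fin.Subset.Properties
open import Data.Nat
  using (ℕ; zero; suc; pred; _+_; _∸_; _≤_; _<_; z≤n; s≤s; s≤s⁻¹; NonZero; >-nonZero; >-nonZero⁻¹)
open import Data.Nat.Properties
  using (≤-trans; ≤-reflexive; ≤-antisym; <-irrefl; n≢0⇒n>0; m≤n+m∸n;
         +-cancelʳ-≡; +-comm; +-monoʳ-≤; +-suc; suc-injective; ≮⇒≥; <⇒≱; suc-pred; 1+n≢n;
         module ≤-Reasoning)
  renaming (_≟_ to _≟ℕ_)
open import Data.Product using (∃; Σ; _×_; _,_; proj₁; proj₂)
open import Data.Sum using (_⊎_; inj₁; inj₂; [_,_]′)
open import Data.Sum.Properties using (inj₂-injective)
open import Data.Sum.Algebra using (⊎-assoc; ⊎-comm; ⊎-cong)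
open import Data.Sum.Relation.Binary.Pointwise using (Pointwise; inj₁; inj₂)
open import Data.Unit using (tt)
open import Data.Vec using ([]; _∷_; here; there)
open import Data.Vec.Properties using (lookup∘tabulate; []=⇒lookup; lookup⇒[]=)
open import Function.Base using (id; _∘_)
open import Function.Bundles using (_⇔_; _↔_; mk⇔; Equivalence; Inverse)
open import Function.Construct.Composition
  using () renaming (_↔-∘_ to infixr 8 _↔∘_; _⇔-∘_ to _⇔∘_)
open import Function.Construct.Identity using (↔-id)
open import Function.Construct.Symmetry using (↔-sym)
open import Level using (0ℓ)
open import Relation.Binary.PropositionalEquality
  using (_≡_; _≢_; refl; sym; trans; cong; subst; subst₂; ≢-sym)
open import Relation.Nullary using (¬_; Dec; yes; no; does; contradiction)
open import Relation.Nullary.Decidable using (dec-true; ¬?; decidable-stable; _×-dec_; _→-dec_)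
open import Relation.Unary using (Pred; Decidable)

private
  variable
    m n : ℕ

open Inverse using (to; from; strictlyInverseˡ; strictlyInverseʳ)

-- Subsets of Fin n

x∉p-x : (p : Subset n) (x : Fin n) → x ∉ p - x
x∉p-x (_ ∷ p) zero    ()
x∉p-x (_ ∷ p) (suc x) (there x∈) = x∉p-x p x x∈

x∈p-y⇒x≢y : (p : Subset n) {x y : Fin n} → x ∈ p - y → x ≢ y
x∈p-y⇒x≢y p x∈ refl = x∉p-x p _ x∈

x∈p-y⇒x∈p : (p : Subset n) {x y : Fin n} → x ∈ p - y → x ∈ p
x∈p-y⇒x∈p p = p─q⊆p p _

x∈p⇒∣p∣≡1+∣p-x∣ : {p : Subset n} {x : Fin n} → x ∈ p → ∣ p ∣ ≡ suc ∣ p - x ∣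
x∈p⇒∣p∣≡1+∣p-x∣ {p = _ ∷ p} here = cong suc (cong ∣_∣ (sym (p─⊥≡p p)))
x∈p⇒∣p∣≡1+∣p-x∣ {p = inside  ∷ p} (there x∈p) = cong suc (x∈p⇒∣p∣≡1+∣p-x∣ x∈p)
x∈p⇒∣p∣≡1+∣p-x∣ {p = outside ∷ p} (there x∈p) = x∈p⇒∣p∣≡1+∣p-x∣ x∈p

x∉p⇒p-x≡p : {p : Subset n} {x : Fin n} → x ∉ p → p - x ≡ p
x∉p⇒p-x≡p {p = p} x∉p =
  ⊆-antisym (x∈p-y⇒x∈p p) λ y∈p → x∈p∧x≢y⇒x∈p-y y∈p λ { refl → x∉p y∈p }

∣p∣≢0⇒Nonempty : (p : Subset n) → ∣ p ∣ ≢ 0 → Nonempty p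
∣p∣≢0⇒Nonempty {n} p ∣p∣≢0 with nonempty? p
... | yes ne = ne
... | no  ¬ne = contradiction (trans (cong ∣_∣ (Empty-unique ¬ne)) (∣⊥∣≡0 n)) ∣p∣≢0

Nonempty⇒0<∣p∣ : {p : Subset n} → Nonempty p → 0 < ∣ p ∣
Nonempty⇒0<∣p∣ (_ , x∈p) = ≤-trans (s≤s z≤n) (x∈p⇒∣p-x∣<∣p∣ x∈p)

1<∣p∣⇒distinct : (p : Subset n) → 1 < ∣ p ∣ → ∃ λ u → ∃ λ v → u ∈ p × v ∈ p × u ≢ v
1<∣p∣⇒distinct p 1<∣p∣ with ∣p∣≢0⇒Nonempty p (λ eq → contradiction (subst (1 <_) eq 1<∣p∣) λ ())
... | u , u∈p with ∣p∣≢0⇒Nonempty (p - u)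
  (λ eq → <-irrefl refl (subst (1 <_) (trans (x∈p⇒∣p∣≡1+∣p-x∣ u∈p) (cong suc eq)) 1<∣p∣))
... | v , v∈ = u , v , u∈p , x∈p-y⇒x∈p p v∈ , ≢-sym (x∈p-y⇒x≢y p v∈)

∣p∣≡1⇒unique : {p : Subset n} {x y : Fin n} → ∣ p ∣ ≡ 1 → x ∈ p → y ∈ p → x ≡ y
∣p∣≡1⇒unique {p = p} {x} {y} ∣p∣≡1 x∈p y∈p with x ≟ y
... | yes x≡y = x≡y
... | no  x≢y = contradiction
  (Nonempty⇒0<∣p∣ (x , x∈p∧x≢y⇒x∈p-y x∈p x≢y))
  (<-irrefl (sym (suc-injective (trans (sym (x∈p⇒∣p∣≡1+∣p-x∣ y∈p)) ∣p∣≡1))))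

∣p∣≡∣p∩q∣+∣p∩∁q∣ : (p q : Subset n) → ∣ p ∣ ≡ ∣ p ∩ q ∣ + ∣ p ∩ ∁ q ∣
∣p∣≡∣p∩q∣+∣p∩∁q∣ []            []            = refl
∣p∣≡∣p∩q∣+∣p∩∁q∣ (outside ∷ p) (_       ∷ q) = ∣p∣≡∣p∩q∣+∣p∩∁q∣ p q
∣p∣≡∣p∩q∣+∣p∩∁q∣ (inside  ∷ p) (inside  ∷ q) = cong suc (∣p∣≡∣p∩q∣+∣p∩∁q∣ p q)
∣p∣≡∣p∩q∣+∣p∩∁q∣ (inside  ∷ p) (outside ∷ q) =
  trans (cong suc (∣p∣≡∣p∩q∣+∣p∩∁q∣ p q)) (sym (+-suc _ _))

-- A relation is used because images need to exist on `p` only. The image `j` of the head is removed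
-- from `q`, and injectivity keeps all later images different from it.
∣p∣≤∣q∣-via : (p : Subset m) (q : Subset n) (R : Fin m → Fin n → Set) →
  (∀ {i} → i ∈ p → ∃ λ j → j ∈ q × R i j) →
  (∀ {i i′ j} → i ∈ p → i′ ∈ p → R i j → R i′ j → i ≡ i′) →
  ∣ p ∣ ≤ ∣ q ∣
∣p∣≤∣q∣-via []            q R total inj = z≤n
∣p∣≤∣q∣-via (outside ∷ p) q R total inj =
  ∣p∣≤∣q∣-via p q (R ∘ suc) (total ∘ there)
    λ i∈ i′∈ r r′ → Fin-suc-injective (inj (there i∈) (there i′∈) r r′)
∣p∣≤∣q∣-via (inside ∷ p) q R total inj with total here
... | j , j∈q , r = ≤-trans
  (s≤s (∣p∣≤∣q∣-via p (q - j) (R ∘ suc) total′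
    λ i∈ i′∈ r r′ → Fin-suc-injective (inj (there i∈) (there i′∈) r r′)))
  (x∈p⇒∣p-x∣<∣p∣ j∈q)
  where
  total′ : ∀ {i} → i ∈ p → ∃ λ j′ → j′ ∈ q - j × R (suc i) j′
  total′ i∈p with total (there i∈p)
  ... | j′ , j′∈q , r′ = j′ , x∈p∧x≢y⇒x∈p-y j′∈q j′≢j , r′
    where
    j′≢j : j′ ≢ j
    j′≢j refl with inj here (there i∈p) r r′
    ... | ()

bounded-injection : (p : Subset n) (f : Fin n → ℕ) (b : ℕ) →
  (∀ {u} → u ∈ p → f u < b) →
  (∀ {u v} → u ∈ p → v ∈ p → f u ≡ f v → u ≡ v) →
  ∣ p ∣ ≤ b
bounded-injection p f b bound inj = ≤-trans
  (∣p∣≤∣q∣-via p full (λ u j → f u ≡ toℕ j)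
    (λ u∈p → fromℕ< (bound u∈p) , ∈⊤ , sym (toℕ-fromℕ< (bound u∈p)))
    λ u∈p v∈p fu≡j fv≡j → inj u∈p v∈p (trans fu≡j (sym fv≡j)))
  (≤-reflexive (∣⊤∣≡n b))

-- Pigeonhole: at most `∣ p ∣ - 1` values are available. For empty `p` the bound and injectivity
-- would hold vacuously.
¬injection-below-∣p∣-1 : (p : Subset n) → 0 < ∣ p ∣ → (f : Fin n → ℕ) →
  (∀ {u} → u ∈ p → suc (f u) < ∣ p ∣) →
  ¬ (∀ {u v} → u ∈ p → v ∈ p → f u ≡ f v → u ≡ v)
¬injection-below-∣p∣-1 p 0<∣p∣ f bound inj = <-irrefl refl
  (≤-trans (s≤s (bounded-injection p f (pred ∣ p ∣) bound′ inj)) (≤-reflexive 1+pred))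
  where
  1+pred : suc (pred ∣ p ∣) ≡ ∣ p ∣
  1+pred = suc-pred ∣ p ∣ {{>-nonZero 0<∣p∣}}

  bound′ : ∀ {u} → u ∈ p → f u < pred ∣ p ∣
  bound′ u∈p = s≤s⁻¹ (≤-trans (bound u∈p) (≤-reflexive (sym 1+pred)))

-- Neighbourhoods

module _ (G : Graph n) where

  HasNeighbour : Pred (Fin n) 0ℓ
  HasNeighbour v = ∃ (Adj G v)

  hasNeighbour? : Decidable HasNeighbour
  hasNeighbour? v = any? (adj? G v)

  ∈N⁺ : ∀ {v u} → Adj G v u → u ∈ N G v
  ∈N⁺ {v} {u} a = lookup⇒[]= u (N G v) (trans (lookup∘tabulate _ u) (dec-true (adj? G v u) a))

  ∈N⁻ : ∀ {v u} → u ∈ N G v → Adj G v u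
  ∈N⁻ {v} {u} u∈ = witness (adj? G v u) (trans (sym (lookup∘tabulate _ u)) ([]=⇒lookup u∈))
    where
    witness : ∀ {A : Set} (d : Dec A) → does d ≡ true → A
    witness (yes a) _ = a

  Adj⇒≢ : ∀ {u v} → Adj G u v → u ≢ v
  Adj⇒≢ a refl = Graph.irrefl G a

  -- In the subgraph induced by `U` the degrees `0` and `∣ U ∣ - 1` exclude each other, which leaves
  -- at most `∣ U ∣ - 1` values for `∣ U ∣` vertices.
  degrees-not-distinct : (U : Subset n) → 1 < ∣ U ∣ →
    ¬ (∀ {u v} → u ∈ U → v ∈ U → ∣ N G u ∩ U ∣ ≡ ∣ N G v ∩ U ∣ → u ≡ v)
  degrees-not-distinct U 1<∣U∣ inj with any? (λ u → u ∈? U ×-dec ∣ N G u ∩ U ∣ ≟ℕ 0)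
  ... | yes (u , u∈U , du≡0) = ¬injection-below-∣p∣-1 U (≤-trans (s≤s z≤n) 1<∣U∣) _ bound inj
    where
    u-isolated : ∀ {v} → v ∈ U → ¬ Adj G u v
    u-isolated v∈U a = <-irrefl (sym du≡0) (Nonempty⇒0<∣p∣ (_ , x∈p∩q⁺ (∈N⁺ a , v∈U)))

    bound : ∀ {v} → v ∈ U → suc ∣ N G v ∩ U ∣ < ∣ U ∣
    bound {v} v∈U with v ≟ u
    ... | yes refl = subst (λ d → suc d < ∣ U ∣) (sym du≡0) 1<∣U∣
    ... | no  v≢u  = ≤-trans
      (s≤s (≤-trans (s≤s (p⊆q⇒∣p∣≤∣q∣ sub)) (x∈p⇒∣p-x∣<∣p∣ (x∈p∧x≢y⇒x∈p-y u∈U (≢-sym v≢u)))))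
      (x∈p⇒∣p-x∣<∣p∣ v∈U)
      where
      -- Both `v` itself and the isolated `u` are missing, so the degree is at most `∣ U ∣ - 2`.
      sub : N G v ∩ U ⊆ U - v - u
      sub w∈ with x∈p∩q⁻ (N G v) U w∈
      ... | w∈N , w∈U = x∈p∧x≢y⇒x∈p-y
        (x∈p∧x≢y⇒x∈p-y w∈U (≢-sym (Adj⇒≢ (∈N⁻ w∈N))))
        λ { refl → u-isolated v∈U (Graph.sym G (∈N⁻ w∈N)) }
  -- No degree is `0` here, so `pred` stays injective on the degrees and makes them at most
  -- `∣ U ∣ - 2`.
  ... | no none = ¬injection-below-∣p∣-1 U (≤-trans (s≤s z≤n) 1<∣U∣) (λ v → pred ∣ N G v ∩ U ∣)
    (λ v∈U → subst (_< ∣ U ∣) (sym (1+pred v∈U)) (bound v∈U))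
    λ u∈U v∈U eq → inj u∈U v∈U
      (trans (sym (1+pred u∈U)) (trans (cong suc eq) (1+pred v∈U)))
    where
    1+pred : ∀ {v} → v ∈ U → suc (pred ∣ N G v ∩ U ∣) ≡ ∣ N G v ∩ U ∣
    1+pred v∈U = suc-pred _ {{>-nonZero (n≢0⇒n>0 λ dv≡0 → none (_ , v∈U , dv≡0))}}

    bound : ∀ {v} → v ∈ U → ∣ N G v ∩ U ∣ < ∣ U ∣
    bound {v} v∈U = ≤-trans (s≤s (p⊆q⇒∣p∣≤∣q∣ sub)) (x∈p⇒∣p-x∣<∣p∣ v∈U)
      where
      sub : N G v ∩ U ⊆ U - v
      sub w∈ with x∈p∩q⁻ (N G v) U w∈
      ... | w∈N , w∈U = x∈p∧x≢y⇒x∈p-y w∈U (≢-sym (Adj⇒≢ (∈N⁻ w∈N)))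

-- Irregular domination

  γir≤ : ∀ {D} → IrregularDominating G D → γir G ≤ ∣ D ∣
  γir≤ {D} = proj₂ (proj₂ (smallest G)) D

  -- `γir G` is itself the size of an irregular dominating set; this turns lower bounds for all such
  -- sets into lower bounds for `γir G`.
  γir-elim : (P : ℕ → Set) → (∀ D → IrregularDominating G D → P ∣ D ∣) → P (γir G)
  γir-elim _ p = p _ (proj₁ (proj₂ (smallest G)))

  edgeless⇒γir≡n : (∀ u v → ¬ Adj G u v) → γir G ≡ n
  edgeless⇒γir≡n edgeless = ≤-antisym (∣p∣≤n (proj₁ (smallest G))) (γir-elim (n ≤_) bound)
    where
    bound : ∀ D → IrregularDominating G D → n ≤ ∣ D ∣
    bound D (dom , _) = subst (_≤ ∣ D ∣) (∣⊤∣≡n n) (p⊆q⇒∣p∣≤∣q∣ {p = full} λ {v} _ →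
      decidable-stable (v ∈? D) λ v∉D → edgeless v _ (proj₁ (proj₂ (dom v v∉D))))

  -- Leave out only `u`: it is dominated by `v`, and irregularity is vacuous.
  edge⇒γir<n : ∀ {u v} → Adj G u v → γir G < n
  edge⇒γir<n {u} {v} a = ≤-trans (s≤s (γir≤ (dom , irr)))
    (≤-trans (x∈p⇒∣p-x∣<∣p∣ {x = u} (∈⊤)) (≤-reflexive (∣⊤∣≡n n)))
    where
    excluded : ∀ {x} → x ∉ full - u → x ≡ u
    excluded {x} x∉ = decidable-stable (x ≟ u) λ x≢u → x∉ (x∈p∧x≢y⇒x∈p-y ∈⊤ x≢u)

    dom : Dominating G (full - u)
    dom x x∉ with excluded x∉
    ... | refl = v , a , x∈p∧x≢y⇒x∈p-y ∈⊤ (≢-sym (Adj⇒≢ a))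

    irr : ∀ x y → x ∉ full - u → y ∉ full - u → x ≢ y → _
    irr x y x∉ y∉ x≢y = contradiction (trans (excluded x∉) (sym (excluded y∉))) x≢y

  N∩∁pair : ∀ u v → N G u ∩ (full - u - v) ≡ N G u - v
  N∩∁pair u v = ⊆-antisym ⊆₁ ⊆₂
    where
    ⊆₁ : N G u ∩ (full - u - v) ⊆ N G u - v
    ⊆₁ x∈ with x∈p∩q⁻ (N G u) _ x∈
    ... | x∈N , x∈D = x∈p∧x≢y⇒x∈p-y x∈N (x∈p-y⇒x≢y (full - u) x∈D)

    ⊆₂ : N G u - v ⊆ N G u ∩ (full - u - v)
    ⊆₂ x∈ = x∈p∩q⁺ (x∈N ,
      x∈p∧x≢y⇒x∈p-y (x∈p∧x≢y⇒x∈p-y ∈⊤ (≢-sym (Adj⇒≢ (∈N⁻ x∈N)))) (x∈p-y⇒x≢y (N G u) x∈))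
      where x∈N = x∈p-y⇒x∈p (N G u) x∈

  -- The hypotheses say that the complement of `u` and `v` is irregular dominating: `N G u - v`
  -- consists of the neighbours of `u` in it.
  pair⇒1+γir<n : ∀ {u v} → u ≢ v → Nonempty (N G u - v) → Nonempty (N G v - u) →
    ∣ N G u - v ∣ ≢ ∣ N G v - u ∣ → suc (γir G) < n
  pair⇒1+γir<n {u} {v} u≢v ne-u ne-v counts≢ = begin-strict
    suc (γir G)        ≤⟨ s≤s (γir≤ (dom , irr)) ⟩
    suc ∣ D ∣          ≤⟨ x∈p⇒∣p-x∣<∣p∣ (x∈p∧x≢y⇒x∈p-y ∈⊤ (≢-sym u≢v)) ⟩
    ∣ full - u ∣       <⟨ x∈p⇒∣p-x∣<∣p∣ (∈⊤ {x = u}) ⟩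
    ∣ full {n} ∣       ≡⟨ ∣⊤∣≡n n ⟩
    n                  ∎
    where
    open ≤-Reasoning

    D = full - u - v

    count-u : N G u ∩ D ≡ N G u - v
    count-u = N∩∁pair u v

    count-v : N G v ∩ D ≡ N G v - u
    count-v = trans (cong (N G v ∩_) (p─x─y≡p─y─x full u v)) (N∩∁pair v u)

    excluded : ∀ {x} → x ∉ D → x ≡ u ⊎ x ≡ v
    excluded {x} x∉ with x ≟ u | x ≟ v
    ... | yes x≡u | _ = inj₁ x≡u
    ... | no  _   | yes x≡v = inj₂ x≡v
    ... | no  x≢u | no  x≢v = contradiction (x∈p∧x≢y⇒x∈p-y (x∈p∧x≢y⇒x∈p-y ∈⊤ x≢u) x≢v) x∉

    dominated : ∀ {x p} → N G x ∩ D ≡ p → Nonempty p → ∃ λ w → Adj G x w × w ∈ D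
    dominated {x} refl (w , w∈) with x∈p∩q⁻ (N G x) D w∈
    ... | w∈N , w∈D = w , ∈N⁻ w∈N , w∈D

    dom : Dominating G D
    dom x x∉ with excluded x∉
    ... | inj₁ refl = dominated count-u ne-u
    ... | inj₂ refl = dominated count-v ne-v

    counts : ∣ N G u ∩ D ∣ ≢ ∣ N G v ∩ D ∣
    counts = subst₂ (λ p q → ∣ p ∣ ≢ ∣ q ∣) (sym count-u) (sym count-v) counts≢

    irr : ∀ x y → x ∉ D → y ∉ D → x ≢ y → ∣ N G x ∩ D ∣ ≢ ∣ N G y ∩ D ∣
    irr x y x∉ y∉ x≢y with excluded x∉ | excluded y∉
    ... | inj₁ refl | inj₁ refl = contradiction refl x≢y
    ... | inj₁ refl | inj₂ refl = counts
    ... | inj₂ refl | inj₁ refl = ≢-sym counts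
    ... | inj₂ refl | inj₂ refl = contradiction refl x≢y

  -- Otherwise `u` and `v` could both be left out. If they are not adjacent, the counts are their
  -- degrees; if they are, both counts drop by one and stay distinct, and only a leaf is left
  -- undominated.
  deg-≢⇒adjacent-leaf : n ≤ suc (γir G) → ∀ {u v} → HasNeighbour u → HasNeighbour v →
    ∣ N G u ∣ ≢ ∣ N G v ∣ → Adj G u v × (∣ N G u ∣ ≡ 1 ⊎ ∣ N G v ∣ ≡ 1)
  deg-≢⇒adjacent-leaf n≤ {u} {v} (x , ux) (y , vy) deg≢ with adj? G u v
  ... | no ¬a = contradiction n≤ (<⇒≱ (pair⇒1+γir<n u≢v
    (x , subst (x ∈_) (sym N-u) (∈N⁺ ux)) (y , subst (y ∈_) (sym N-v) (∈N⁺ vy))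
    (subst₂ (λ p q → ∣ p ∣ ≢ ∣ q ∣) (sym N-u) (sym N-v) deg≢)))
    where
    u≢v : u ≢ v
    u≢v refl = deg≢ refl

    N-u : N G u - v ≡ N G u
    N-u = x∉p⇒p-x≡p (¬a ∘ ∈N⁻)

    N-v : N G v - u ≡ N G v
    N-v = x∉p⇒p-x≡p (¬a ∘ Graph.sym G ∘ ∈N⁻)
  ... | yes a with ∣ N G u ∣ ≟ℕ 1 | ∣ N G v ∣ ≟ℕ 1
  ... | yes leaf | _ = a , inj₁ leaf
  ... | no  _    | yes leaf = a , inj₂ leaf
  ... | no  ¬leaf-u | no ¬leaf-v = contradiction n≤ (<⇒≱ (pair⇒1+γir<n (Adj⇒≢ a)
    (∣p∣≢0⇒Nonempty _ λ eq → ¬leaf-u (trans deg-u (cong suc eq)))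
    (∣p∣≢0⇒Nonempty _ λ eq → ¬leaf-v (trans deg-v (cong suc eq)))
    λ eq → deg≢ (trans deg-u (trans (cong suc eq) (sym deg-v)))))
    where
    deg-u : ∣ N G u ∣ ≡ suc ∣ N G u - v ∣
    deg-u = x∈p⇒∣p∣≡1+∣p-x∣ (∈N⁺ a)

    deg-v : ∣ N G v ∣ ≡ suc ∣ N G v - u ∣
    deg-v = x∈p⇒∣p∣≡1+∣p-x∣ (∈N⁺ (Graph.sym G a))

-- Stars and regular graphs, up to isolated vertices

  -- A star plus isolated vertices, expressed through edges alone.
  StarCentre : Fin n → Set
  StarCentre c = HasNeighbour c × (∀ u v → Adj G u v → u ≡ c ⊎ v ≡ c)

  AlmostRegular : ℕ → Set
  AlmostRegular r = ∃ HasNeighbour × (∀ v → HasNeighbour v → ∣ N G v ∣ ≡ r)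

  -- A non-isolated `w` other than `c` that is no leaf differs in degree from `u`, so it would be a
  -- second neighbour of `u`. If `w` is a leaf, it differs in degree from `c`, so it is attached to
  -- `c`.
  leaf⇒StarCentre : n ≤ suc (γir G) → ∀ {u c} → Adj G u c → ∣ N G u ∣ ≡ 1 → ∣ N G c ∣ ≢ 1 →
    StarCentre c
  leaf⇒StarCentre n≤ {u} {c} uc leaf-u ¬leaf-c = (u , cu) , centre
    where
    cu : Adj G c u
    cu = Graph.sym G uc

    leaf-at-c : ∀ w → HasNeighbour w → w ≢ c → ∣ N G w ∣ ≡ 1 × Adj G w c
    leaf-at-c w hw w≢c with ∣ N G w ∣ ≟ℕ 1
    ... | yes leaf-w = leaf-w , proj₁ (deg-≢⇒adjacent-leaf n≤ hw (u , cu)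
      λ eq → ¬leaf-c (trans (sym eq) leaf-w))
    ... | no ¬leaf-w = contradiction
      (∣p∣≡1⇒unique leaf-u (∈N⁺ (Graph.sym G wu)) (∈N⁺ uc)) w≢c
      where
      wu : Adj G w u
      wu = proj₁ (deg-≢⇒adjacent-leaf n≤ hw (c , uc) λ eq → ¬leaf-w (trans eq leaf-u))

    centre : ∀ x y → Adj G x y → x ≡ c ⊎ y ≡ c
    centre x y xy with x ≟ c
    ... | yes x≡c = inj₁ x≡c
    ... | no  x≢c with leaf-at-c x (y , xy) x≢c
    ... | leaf-x , xc = inj₂ (∣p∣≡1⇒unique leaf-x (∈N⁺ xy) (∈N⁺ xc))

  star-or-regular : n ≤ suc (γir G) → ∃ HasNeighbour →
    ∃ StarCentre ⊎ ∃ λ r → 1 ≤ r × AlmostRegular r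
  star-or-regular n≤ (a , b , ab)
    with all? (λ v → hasNeighbour? v →-dec ∣ N G v ∣ ≟ℕ ∣ N G a ∣)
  ... | yes all = inj₂ (∣ N G a ∣ , Nonempty⇒0<∣p∣ (b , ∈N⁺ ab) , (a , b , ab) , all)
  ... | no ¬all with any? (λ v → hasNeighbour? v ×-dec ¬? (∣ N G v ∣ ≟ℕ ∣ N G a ∣))
  ... | no none = contradiction
    (λ v hv → decidable-stable (∣ N G v ∣ ≟ℕ ∣ N G a ∣) λ deg≢ → none (v , hv , deg≢)) ¬all
  ... | yes (v , hv , deg≢) with deg-≢⇒adjacent-leaf n≤ hv (b , ab) deg≢
  -- Of two adjacent vertices of different degree one is a leaf; the other one becomes the centre.
  ... | va , inj₁ leaf-v = inj₁ (a , leaf⇒StarCentre n≤ va leaf-v (deg≢ ∘ trans leaf-v ∘ sym))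
  ... | va , inj₂ leaf-a = inj₁ (v , leaf⇒StarCentre n≤ (Graph.sym G va) leaf-a
    λ leaf-v → deg≢ (trans leaf-v (sym leaf-a)))

  -- Both converses reduce to refuting two omitted vertices, since `∁ D` has `n ∸ ∣ D ∣` elements.
  bound-by-∁ : (∀ D → IrregularDominating G D → ¬ 1 < ∣ ∁ D ∣) → n ≤ suc (γir G)
  bound-by-∁ small = γir-elim (λ k → n ≤ suc k) λ D irr →
    subst (n ≤_) (+-comm ∣ D ∣ 1) (≤-trans (m≤n+m∸n n ∣ D ∣)
      (+-monoʳ-≤ ∣ D ∣ (subst (_≤ 1) (∣∁p∣≡n∸∣p∣ D) (≮⇒≥ (small D irr)))))

  StarCentre⇒n≤1+γir : ∀ {c} → StarCentre c → n ≤ suc (γir G)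
  StarCentre⇒n≤1+γir {c} (_ , centre) = bound-by-∁ small
    where
    small : ∀ D → IrregularDominating G D → ¬ 1 < ∣ ∁ D ∣
    small D (dom , irr) 1<∣∁D∣ with 1<∣p∣⇒distinct (∁ D) 1<∣∁D∣
    ... | u , v , u∈∁D , v∈∁D , u≢v =
      irr u v u∉D v∉D u≢v (cong ∣_∣ (⊆-antisym (N∩D⊆ u≢c vc) (N∩D⊆ v≢c uc)))
      where
      u∉D = x∈∁p⇒x∉p u∈∁D
      v∉D = x∈∁p⇒x∉p v∈∁D

      c-adjacent : ∀ {x} → x ∉ D → x ≢ c → Adj G x c × c ∈ D
      c-adjacent {x} x∉D x≢c with dom x x∉D
      ... | y , xy , y∈D with centre x y xy
      ... | inj₁ x≡c = contradiction x≡c x≢c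
      ... | inj₂ refl = xy , y∈D

      -- If `u` were `c`, then `v` could only be dominated by `u`, which is not in `D`.
      u≢c : u ≢ c
      u≢c refl = u∉D (proj₂ (c-adjacent v∉D (≢-sym u≢v)))

      v≢c : v ≢ c
      v≢c refl = v∉D (proj₂ (c-adjacent u∉D u≢v))

      uc = proj₁ (c-adjacent u∉D u≢c)
      vc = proj₁ (c-adjacent v∉D v≢c)

      N∩D⊆ : ∀ {x y} → x ≢ c → Adj G y c → N G x ∩ D ⊆ N G y ∩ D
      N∩D⊆ {x} x≢c yc w∈ with x∈p∩q⁻ (N G x) D w∈
      ... | w∈N , w∈D with centre x _ (∈N⁻ w∈N)
      ... | inj₁ x≡c = contradiction x≡c x≢c
      ... | inj₂ refl = x∈p∩q⁺ (∈N⁺ yc , w∈D)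

  -- The neighbours inside and outside `D` add up to `r`, so distinct counts inside `D` would force
  -- distinct degrees in the subgraph induced by `∁ D`.
  AlmostRegular⇒n≤1+γir : ∀ {r} → AlmostRegular r → n ≤ suc (γir G)
  AlmostRegular⇒n≤1+γir {r} (_ , regular) = bound-by-∁ small
    where
    small : ∀ D → IrregularDominating G D → ¬ 1 < ∣ ∁ D ∣
    small D (dom , irr) 1<∣∁D∣ = degrees-not-distinct (∁ D) 1<∣∁D∣ inj
      where
      degree : ∀ {u} → u ∈ ∁ D → ∣ N G u ∩ D ∣ + ∣ N G u ∩ ∁ D ∣ ≡ r
      -- A vertex outside `D` is dominated, hence not isolated, so `regular` applies to it.
      degree {u} u∈ with dom u (x∈∁p⇒x∉p u∈)
      ... | w , uw , _ = trans (sym (∣p∣≡∣p∩q∣+∣p∩∁q∣ (N G u) D)) (regular u (w , uw))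

      inj : ∀ {u v} → u ∈ ∁ D → v ∈ ∁ D → ∣ N G u ∩ ∁ D ∣ ≡ ∣ N G v ∩ ∁ D ∣ → u ≡ v
      inj {u} {v} u∈ v∈ eq = decidable-stable (u ≟ v) λ u≢v →
        irr u v (x∈∁p⇒x∉p u∈) (x∈∁p⇒x∉p v∈) u≢v
          (+-cancelʳ-≡ _ _ _
            (trans (degree u∈) (trans (sym (degree v∈)) (cong (∣ N G v ∩ D ∣ +_) (sym eq)))))

-- Splitting off the isolated vertices

from-injective : {A B : Set} (e : A ↔ B) {x y : B} → from e x ≡ from e y → x ≡ y
from-injective e eq =
  trans (sym (strictlyInverseˡ e _)) (trans (cong (to e) eq) (strictlyInverseˡ e _))

partition : (P : Pred (Fin n) 0ℓ) → Decidable P →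
  ∃ λ t → ∃ λ m → Σ (Fin n ↔ (Fin t ⊎ Fin m)) λ e →
    (∀ i → P (from e (inj₁ i))) × (∀ j → ¬ P (from e (inj₂ j)))
partition {zero}  P P? = 0 , 0 , +↔⊎ , (λ ()) , λ ()
partition {suc n} P P? with partition (P ∘ suc) (P? ∘ suc)
... | t , m , e , Pˡ , Pʳ with P? zero
... | yes p =
  suc t , m ,
  -- Read from right to left: `zero` is split off as `Fin 1`, the rest is partitioned, and `Fin 1`
  -- is merged into `Fin t`.
  ⊎-cong (↔-sym (+↔⊎ {1})) (↔-id _) ↔∘ ↔-sym (⊎-assoc 0ℓ _ _ _) ↔∘
    ⊎-cong (↔-id _) e ↔∘ +↔⊎ {1} ,
  (λ { zero → p ; (suc i) → Pˡ i }) , Pʳ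
... | no ¬p =
  t , suc m ,
  -- Here `Fin 1` has to pass `Fin t` before it can be merged into `Fin m`.
  ⊎-cong (↔-id _) (↔-sym (+↔⊎ {1})) ↔∘ ⊎-assoc 0ℓ _ _ _ ↔∘
    ⊎-cong (⊎-comm _ _) (↔-id _) ↔∘ ↔-sym (⊎-assoc 0ℓ _ _ _) ↔∘
    ⊎-cong (↔-id _) e ↔∘ +↔⊎ {1} ,
  Pˡ , λ { zero → ¬p ; (suc j) → Pʳ j }

module _ (G : Graph n) {t : ℕ} (H : Graph m) where

  -- An isomorphism with `t K₁ ∪ H`, restated over the sum type so that proofs can match on `inj₁`
  -- and `inj₂` instead of handling `splitAt`.
  PulledBackAlong : (Fin n ↔ (Fin t ⊎ Fin m)) → Set
  PulledBackAlong e = ∀ x y →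
    Adj G (from e x) (from e y) ⇔ Pointwise (Adj (t K₁)) (Adj H) x y

  ≃⇒PulledBack : G ≃ t K₁ ∪ H → ∃ PulledBackAlong
  ≃⇒PulledBack iso = e , λ x y →
    subst₂ (λ x′ y′ → Adj G (from e x) (from e y) ⇔ Pointwise (Adj (t K₁)) (Adj H) x′ y′)
      (strictlyInverseˡ e x) (strictlyInverseˡ e y) (_≃_.adjacent iso _ _)
    where
    e : Fin n ↔ (Fin t ⊎ Fin m)
    e = +↔⊎ ↔∘ _≃_.vertices iso

  PulledBack⇒≃ : (e : Fin n ↔ (Fin t ⊎ Fin m)) → PulledBackAlong e → G ≃ t K₁ ∪ H
  PulledBack⇒≃ e adjacent = record
    { vertices = ↔-sym +↔⊎ ↔∘ e
    ; adjacent = λ u v →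
        subst₂ (λ x y → Adj G u v ⇔ Pointwise (Adj (t K₁)) (Adj H) x y)
          (sym (splitAt-join t m (to e u))) (sym (splitAt-join t m (to e v)))
          (subst₂ (λ u′ v′ → Adj G u′ v′ ⇔ Pointwise (Adj (t K₁)) (Adj H) (to e u) (to e v))
            (strictlyInverseʳ e u) (strictlyInverseʳ e v) (adjacent (to e u) (to e v)))
    }

  isolated∪H⇒PulledBack : (e : Fin n ↔ (Fin t ⊎ Fin m)) →
    (∀ i → ¬ HasNeighbour G (from e (inj₁ i))) →
    (∀ i j → Adj G (from e (inj₂ i)) (from e (inj₂ j)) ⇔ Adj H i j) →
    PulledBackAlong e
  isolated∪H⇒PulledBack e isolated adjacent = λ where
    (inj₁ i) _        → mk⇔ (λ a → contradiction (_ , a) (isolated i)) λ { (inj₁ ()) }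
    (inj₂ _) (inj₁ i) →
      mk⇔ (λ a → contradiction (_ , Graph.sym G a) (isolated i)) λ ()
    (inj₂ i) (inj₂ j) →
      mk⇔ (inj₂ ∘ Equivalence.to (adjacent i j)) λ { (inj₂ a) → Equivalence.from (adjacent i j) a }

  module _ (e : Fin n ↔ (Fin t ⊎ Fin m)) (pulledBack : PulledBackAlong e) where

    Adj-from : ∀ {i j} → Adj H i j → Adj G (from e (inj₂ i)) (from e (inj₂ j))
    Adj-from a = Equivalence.from (pulledBack _ _) (inj₂ a)

    Adj-into : ∀ {u v} → Adj G u v →
      ∃ λ i → ∃ λ j → u ≡ from e (inj₂ i) × v ≡ from e (inj₂ j) × Adj H i j
    Adj-into {u} {v} a = reflect (to e u) (to e v)
      (sym (strictlyInverseʳ e u)) (sym (strictlyInverseʳ e v)) a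
      where
      -- Writing the endpoints as images of `x` and `y` allows a case split on these; only `inj₂`
      -- survives, as `t K₁` has no edges.
      reflect : ∀ x y {u v} → u ≡ from e x → v ≡ from e y → Adj G u v →
        ∃ λ i → ∃ λ j → u ≡ from e (inj₂ i) × v ≡ from e (inj₂ j) × Adj H i j
      reflect x y refl refl a with x | y | Equivalence.to (pulledBack x y) a
      ... | inj₂ i | inj₂ j | inj₂ b = i , j , refl , refl , b

    -- All neighbours lie in the image of `H`, so matching `j` with `from e (inj₂ j)` bounds each
    -- degree by the other.
    degree-from : ∀ i → ∣ N G (from e (inj₂ i)) ∣ ≡ ∣ N H i ∣
    degree-from i = ≤-antisym
      (∣p∣≤∣q∣-via (N G (from e (inj₂ i))) (N H i) (λ v j → v ≡ from e (inj₂ j))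
        restrict λ _ _ v≡ v′≡ → trans v≡ (sym v′≡))
      (∣p∣≤∣q∣-via (N H i) (N G (from e (inj₂ i))) (λ j v → v ≡ from e (inj₂ j))
        (λ j∈ → _ , ∈N⁺ G (Adj-from (∈N⁻ H j∈)) , refl)
        λ _ _ v≡ v≡′ → inj₂-injective (from-injective e (trans (sym v≡) v≡′)))
      where
      restrict : ∀ {v} → v ∈ N G (from e (inj₂ i)) → ∃ λ j → j ∈ N H i × v ≡ from e (inj₂ j)
      restrict v∈ with Adj-into (∈N⁻ G v∈)
      ... | i′ , j , i≡i′ , v≡j , a with from-injective e i≡i′
      ... | refl = j , ∈N⁺ H a , v≡j

induced : Graph n → (Fin m → Fin n) → Graph m
induced G f = record
  { Adj    = λ i j → Adj G (f i) (f j)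
  ; adj?   = λ i j → adj? G (f i) (f j)
  ; sym    = Graph.sym G
  ; irrefl = Graph.irrefl G
  }

-- Stars and regular graphs as isomorphism types

module _ (G : Graph n) where

  Star : ℕ → ℕ → Set
  Star t r = G ≃ t K₁ ∪ K₁, r

  StarCentre⇒Star : ∀ {c} → StarCentre G c → ∃ λ t → ∃ λ r → 1 ≤ r × Star t r
  StarCentre⇒Star {c} ((w , cw) , centre)
    with partition (¬_ ∘ HasNeighbour G) (¬? ∘ hasNeighbour? G)
  ... | t , m , e , isolated , ¬isolated =
    centre-to-zero e isolated ¬isolated (to e c) (strictlyInverseʳ e c)
    where
    star : ∀ {r} (e : Fin n ↔ (Fin t ⊎ Fin (suc r))) → from e (inj₂ zero) ≡ c →
      (∀ i → ¬ HasNeighbour G (from e (inj₁ i))) →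
      (∀ j → ¬ ¬ HasNeighbour G (from e (inj₂ j))) →
      1 ≤ r × Star t r
    star {r} e refl isolated ¬isolated =
      1≤r (Adj-into G (K₁, r) e pb cw) , PulledBack⇒≃ G (K₁, r) e pb
      where
      leaf≢c : ∀ {j} → from e (inj₂ (suc j)) ≢ c
      leaf≢c eq with from-injective e eq
      ... | ()

      leaf-c : ∀ j → Adj G (from e (inj₂ (suc j))) c
      -- A non-isolated vertex other than `c` lies on some edge; that edge contains `c`, which must
      -- be its other end.
      leaf-c j = decidable-stable (adj? G _ c) λ ¬a → ¬isolated (suc j) λ (v , jv) →
        [ leaf≢c , (λ { refl → ¬a jv }) ]′ (centre _ v jv)

      adjacent : ∀ i j → Adj G (from e (inj₂ i)) (from e (inj₂ j)) ⇔ StarAdj i j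
      adjacent zero    zero    = mk⇔ (Graph.irrefl G) λ ()
      adjacent zero    (suc j) = mk⇔ _ λ _ → Graph.sym G (leaf-c j)
      adjacent (suc i) zero    = mk⇔ _ λ _ → leaf-c i
      adjacent (suc i) (suc j) = mk⇔ (λ a → [ leaf≢c , leaf≢c ]′ (centre _ _ a)) λ ()

      pb : PulledBackAlong G (K₁, r) e
      pb = isolated∪H⇒PulledBack G (K₁, r) e isolated adjacent

      -- The edge from `c` to `w` becomes a star edge, and one of its ends is a leaf, whose index
      -- inhabits `Fin r`.
      1≤r : ∀ {u v} → (∃ λ i → ∃ λ j →
        u ≡ from e (inj₂ i) × v ≡ from e (inj₂ j) × StarAdj {r} i j) → 1 ≤ r
      1≤r (zero  , suc j , _) = >-nonZero⁻¹ _ {{nonZeroIndex j}}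
      1≤r (suc i , _     , _) = >-nonZero⁻¹ _ {{nonZeroIndex i}}

    centre-to-zero : ∀ {m} (e : Fin n ↔ (Fin t ⊎ Fin m)) →
      (∀ i → ¬ HasNeighbour G (from e (inj₁ i))) →
      (∀ j → ¬ ¬ HasNeighbour G (from e (inj₂ j))) →
      ∀ x → from e x ≡ c → ∃ λ t → ∃ λ r → 1 ≤ r × Star t r
    centre-to-zero e isolated _ (inj₁ i) refl = contradiction (w , cw) (isolated i)
    centre-to-zero {suc r} e isolated ¬isolated (inj₂ c₀) eq =
      -- The transposition moves `c` to index `zero`, the centre of `K₁, r`.
      t , r , star (⊎-cong (↔-id _) (transpose c₀ zero) ↔∘ e) eq isolated (λ _ → ¬isolated _)

  Star⇒StarCentre : ∀ {t r} → 1 ≤ r → Star t r → ∃ (StarCentre G)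
  Star⇒StarCentre {t} {suc r} _ iso with ≃⇒PulledBack G (K₁, suc r) iso
  ... | e , pb = from e (inj₂ zero) ,
    (_ , Adj-from G (K₁, suc r) e pb {zero} {suc zero} tt) , centre
    where
    centre : ∀ u v → Adj G u v → u ≡ from e (inj₂ zero) ⊎ v ≡ from e (inj₂ zero)
    centre u v a with Adj-into G (K₁, suc r) e pb a
    ... | zero  , _     , u≡ , _  , _ = inj₁ u≡
    ... | suc _ , zero  , _  , v≡ , _ = inj₂ v≡

  RegularPart : ℕ → ℕ → Set₁
  RegularPart t r = ∃ λ m → Σ (Graph m) λ H → NonZero m × Regular r H × (G ≃ t K₁ ∪ H)

  -- Deleting the isolated vertices changes no other degree, so the induced graph on the rest is
  -- regular; the given edge makes it nonempty.
  AlmostRegular⇒RegularPart : ∀ {r} → AlmostRegular G r → ∃ λ t → RegularPart t r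
  AlmostRegular⇒RegularPart {r} ((w , hw) , regular)
    with partition (¬_ ∘ HasNeighbour G) (¬? ∘ hasNeighbour? G)
  ... | t , m , e , isolated , ¬isolated =
    t , m , H , nonZeroIndex (proj₁ (Adj-into G H e pb (proj₂ hw))) ,
    (λ i → trans (sym (degree-from G H e pb i))
      (regular _ (decidable-stable (hasNeighbour? G _) (¬isolated i)))) ,
    PulledBack⇒≃ G H e pb
    where
    H = induced G (from e ∘ inj₂)

    pb : PulledBackAlong G H e
    pb = isolated∪H⇒PulledBack G H e isolated λ _ _ → mk⇔ id id

  RegularPart⇒AlmostRegular : ∀ {t r} → 1 ≤ r → RegularPart t r → AlmostRegular G r
  RegularPart⇒AlmostRegular 1≤r (suc m , H , _ , regular , iso) with ≃⇒PulledBack G H iso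
  ... | e , pb = (_ , _ , Adj-from G H e pb (∈N⁻ H (proj₂ neighbour))) , degree
    where
    -- `1 ≤ r` enters here: it gives `H`, and hence `G`, an edge.
    neighbour : Nonempty (N H zero)
    neighbour = ∣p∣≢0⇒Nonempty _ λ eq →
      contradiction (≤-trans 1≤r (≤-reflexive (trans (sym (regular zero)) eq))) λ ()

    degree : ∀ v → HasNeighbour G v → ∣ N G v ∣ ≡ _
    degree v (_ , a) with Adj-into G H e pb a
    ... | i , _ , refl , _ = trans (degree-from G H e pb i) (regular i)

-- The two equivalences

module _ (G : Graph n) where

  γir≡n⇔empty : γir G ≡ n ⇔ G ≃ E n
  γir≡n⇔empty = mk⇔
    (λ eq → record
      { vertices = ↔-id _
      ; adjacent = λ _ _ → mk⇔ (λ a → <-irrefl eq (edge⇒γir<n G a)) λ ()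
      })
    λ iso → edgeless⇒γir≡n G λ u v → Equivalence.to (_≃_.adjacent iso u v)

  1+γir≡n⇔star-or-regular : suc (γir G) ≡ n ⇔
    (∃ λ t → ∃ λ r → 1 ≤ r × (Star G t r ⊎ RegularPart G t r))
  1+γir≡n⇔star-or-regular = mk⇔ ⇒ ⇐
    where
    -- Without edges `γir G` would be `n`.
    edge : suc (γir G) ≡ n → ∃ (HasNeighbour G)
    edge eq = decidable-stable (any? (hasNeighbour? G)) λ none →
      1+n≢n (trans eq (sym (edgeless⇒γir≡n G λ u v a → none (u , v , a))))

    ⇒ : suc (γir G) ≡ n → ∃ λ t → ∃ λ r → 1 ≤ r × (Star G t r ⊎ RegularPart G t r)
    ⇒ eq with star-or-regular G (≤-reflexive (sym eq)) (edge eq)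
    ... | inj₁ (c , centre) with StarCentre⇒Star G centre
    ... | t , r , 1≤r , star = t , r , 1≤r , inj₁ star
    ⇒ eq | inj₂ (r , 1≤r , regular) with AlmostRegular⇒RegularPart G regular
    ... | t , part = t , r , 1≤r , inj₂ part

    ⇐ : (∃ λ t → ∃ λ r → 1 ≤ r × (Star G t r ⊎ RegularPart G t r)) → suc (γir G) ≡ n
    ⇐ (t , r , 1≤r , inj₁ star) with Star⇒StarCentre G 1≤r star
    ... | c , centre =
      ≤-antisym (edge⇒γir<n G (proj₂ (proj₁ centre))) (StarCentre⇒n≤1+γir G centre)
    ⇐ (t , r , 1≤r , inj₂ part) with RegularPart⇒AlmostRegular G 1≤r part
    ... | regular =
      ≤-antisym (edge⇒γir<n G (proj₂ (proj₂ (proj₁ regular)))) (AlmostRegular⇒n≤1+γir G regular)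

-- Positive `n` rules out truncation: at `n = 0` the left side would hold for `k = 0`.
≡n∸1⇔1+≡n : ∀ {k n} .{{_ : NonZero n}} → k ≡ n ∸ 1 ⇔ suc k ≡ n
≡n∸1⇔1+≡n {n = suc _} = mk⇔ (cong suc) suc-injective

theorem4p4 : (n : ℕ) .{{_ : NonZero n}} (G : Graph n) →
    (γir G ≡ n ⇔ G ≃ E n)
    ×
    (γir G ≡ n ∸ 1 ⇔
    (∃ λ (t : ℕ) → ∃ λ (r : ℕ) → 1 ≤ r ×
    ((G ≃ t K₁ ∪ K₁, r)
    ⊎
    (∃ λ (m : ℕ) → Σ (Graph m) λ H →
    NonZero m × Regular r H × (G ≃ t K₁ ∪ H)))))
theorem4p4 n G = γir≡n⇔empty G , 1+γir≡n⇔star-or-regular G ⇔∘ ≡n∸1⇔1+≡n
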